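{- Let $\mathcal{T}$ be a stacked component (with vertex set $\{0,1,\dots,2\,\mathrm{ord}(\ell)-1\}$ and edges as specified in the context), and let $d$ be its graph distance. Let $v,w\in V(\mathcal{T})$ be distinct vertices. If $2\nmid v$ and $2\nmid w$, then $$d(v,w)=\begin{cases}\frac12|v-w| & \text{if } |v-w|\le \mathrm{ord}(\ell)-1,\\ \mathrm{ord}(\ell)-\frac12|v-w| & \text{if } |v-w|\ge\mathrm{ord}(\ell)+1.\end{cases}$$ If $2\mid v$ and $2\nmid w$, then $d(v,w)=1+d(v+1,w)$; and if $2\mid v$ and $2\mid w$, then $d(v,w)=2+d(v+1,w+1)$.
   Context: Let $p$ be a prime with $p\equiv 71$ or $119\pmod{120}$, let $\ell=2$, and let $\mathrm{ord}(\ell)$ be the order, in the ideal class group of $\mathbb{Q}(\sqrt{ -p})$, of a prime ideal above $2$; it is an odd integer $\ge 3$. A stacked component $\mathcal{T}$ (a component of the supersingular $2$-isogeny graph over $\mathbb{F}_p$ after identifying curves up to $\overline{\mathbb{F}_p}$-isomorphism, regarded as a simple undirected graph) is, writing $L=\mathrm{ord}(\ell)$, labelled so that $V(\mathcal{T})=\{0,1,\dots,2L-1\}$ and $$E(\mathcal{T})=\{\{2i,2i+1\}:0\le i\le L-1\}\cup\{\{2i+1,2i+3\}:0\le i\le L-2\}\cup\{\{2L-1,1\}\},$$ i.e. the odd vertices form a cycle and each even vertex $2i$ is a pendant vertex attached to $2i+1$. -}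

module Defs where

open import Level using (Level; _⊔_; 0ℓ) renaming (suc to lsuc)
open import Algebra.Bundles using (CommutativeRing)
open import Data.Nat.Base as Nat using (ℕ; zero; suc; _≤_; _<_; z≤n; s≤s)
import Data.Nat.Properties as ℕ
open import Data.Nat.Divisibility using (_∣_; divides; ∣m+n∣m⇒∣n; m∣m*n)
import Data.Nat.DivMod as ℕ
open import Data.Integer.Base as Int using (ℤ; 0ℤ; 1ℤ)
import Data.Integer.Tactic.RingSolver as ℤ-Solver
open import Data.Fin.Base using (Fin; toℕ; fromℕ<)
import Data.Fin.Properties as Fin
open import Data.List.Base using (List; []; _∷_; _++_; map; upTo)
open import Data.List.Membership.Propositional using (_∈_)
import Data.List.Membership.Propositional.Properties as ∈
import Data.List.Membership.DecPropositional as DecMembership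
open import Data.Product.Base using (Σ-syntax; ∃-syntax; _×_; _,_; proj₁; proj₂)
import Data.Product.Properties as ×
open import Data.Sum.Base as Sum using (_⊎_; inj₁; inj₂)
open import Function.Base using (_∘_)
open import Relation.Binary.Definitions using () renaming (Decidable to Decidable₂)
open import Relation.Binary.PropositionalEquality
  using (_≡_; _≢_; refl; sym; trans; cong; cong₂; subst; isEquivalence)
open import Relation.Nullary using (Dec; yes; no; ¬_; contradiction)
open import Relation.Nullary.Decidable using (¬?; _×-dec_; _⊎-dec_) renaming (map′ to mapDec)
open import Relation.Unary using (Pred; Decidable; _≐_)

module Ideals {c ℓ} (R : CommutativeRing c ℓ) where
  open CommutativeRing R hiding (refl; sym; trans)
  private module R = CommutativeRing R

  record Ideal : Set (lsuc (c ⊔ ℓ)) where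
    field
      Mem      : Pred Carrier (c ⊔ ℓ)
      resp     : ∀ {x y} → x ≈ y → Mem x → Mem y
      0∈       : Mem 0#
      +-closed : ∀ {x y} → Mem x → Mem y → Mem (x + y)
      *-closed : ∀ r {x} → Mem x → Mem (r * x)
  open Ideal public

  record IsPrimeIdeal (P : Ideal) : Set (c ⊔ ℓ) where
    field
      proper : ¬ Mem P 1#
      prime  : ∀ x y → Mem P (x * y) → Mem P x ⊎ Mem P y

  ⟨_⟩ : Carrier → Ideal
  ⟨ g ⟩ = record
    { Mem      = λ x → ∃[ r ] r * g ≈ x
    ; resp     = λ x≈y (r , eq) → r , R.trans eq x≈y
    ; 0∈       = 0# , zeroˡ g
    ; +-closed = λ (r , eq) (s , eq′) →
                   r + s , R.trans (distribʳ g r s) (+-cong eq eq′)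
    ; *-closed = λ t (r , eq) →
                   t * r , R.trans (*-assoc t r g) (*-cong R.refl eq)
    }

  data Product (I J : Ideal) : Pred Carrier (c ⊔ ℓ) where
    mul  : ∀ {x y} → Mem I x → Mem J y → Product I J (x * y)
    null : Product I J 0#
    add  : ∀ {x y} → Product I J x → Product I J y → Product I J (x + y)
    conv : ∀ {x y} → x ≈ y → Product I J x → Product I J y

  infixl 7 _·_
  _·_ : Ideal → Ideal → Ideal
  I · J = record
    { Mem      = Product I J
    ; resp     = conv
    ; 0∈       = null
    ; +-closed = add
    ; *-closed = scale
    }
    where
    scale : ∀ r {x} → Product I J x → Product I J (r * x)
    scale r (mul {x} {y} x∈ y∈) = conv (*-assoc r x y) (mul (*-closed I r x∈) y∈)
    scale r null                = conv (R.sym (zeroʳ r)) null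
    scale r (add {x} {y} p q)   = conv (R.sym (distribˡ r x y)) (add (scale r p) (scale r q))
    scale r (conv x≈y p)        = conv (*-cong R.refl x≈y) (scale r p)

  infixr 8 _^_
  _^_ : Ideal → ℕ → Ideal
  I ^ zero  = ⟨ 1# ⟩
  I ^ suc n = I · I ^ n

  -- Equality in the ideal class group of a domain, for nonzero integral
  -- ideals: I and J differ by the nonzero element β / α of the fraction field.
  infix 4 _∼_
  _∼_ : Ideal → Ideal → Set (c ⊔ ℓ)
  I ∼ J = ∃[ α ] ∃[ β ] α ≉ 0# × β ≉ 0# × Mem (⟨ α ⟩ · I) ≐ Mem (⟨ β ⟩ · J)

  record IsClassOrder (I : Ideal) (n : ℕ) : Set (c ⊔ ℓ) where
    field
      positive : 1 ≤ n
      trivial  : I ^ n ∼ ⟨ 1# ⟩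
      minimal  : ∀ m → 1 ≤ m → I ^ m ∼ ⟨ 1# ⟩ → n ≤ m

infix 5 _⊹_ω
record Quadratic : Set where
  constructor _⊹_ω
  field
    re im : ℤ

module _ (n : ℤ) where
  open Int using (_+_; _*_; -_)

  private
    infixl 6 _⊕_
    infixl 7 _⊗_
    _⊕_ _⊗_ : Quadratic → Quadratic → Quadratic
    (a ⊹ b ω) ⊕ (c ⊹ d ω) = (a + c) ⊹ (b + d) ω
    (a ⊹ b ω) ⊗ (c ⊹ d ω) = (a * c + - (n * (b * d))) ⊹ (a * d + b * c + b * d) ω

    ⊖_ : Quadratic → Quadratic
    ⊖ (a ⊹ b ω) = (- a) ⊹ (- b) ω

    𝟘 𝟙 : Quadratic
    𝟘 = 0ℤ ⊹ 0ℤ ω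
    𝟙 = 1ℤ ⊹ 0ℤ ω

    +-assoc : ∀ x y z → (x ⊕ y) ⊕ z ≡ x ⊕ (y ⊕ z)
    +-assoc (a ⊹ b ω) (c ⊹ d ω) (e ⊹ f ω) = cong₂ _⊹_ω (l a c e) (l b d f)
      where
      l : ∀ a c e → (a + c) + e ≡ a + (c + e)
      l = ℤ-Solver.solve-∀

    +-comm : ∀ x y → x ⊕ y ≡ y ⊕ x
    +-comm (a ⊹ b ω) (c ⊹ d ω) = cong₂ _⊹_ω (l a c) (l b d)
      where
      l : ∀ a c → a + c ≡ c + a
      l = ℤ-Solver.solve-∀

    +-identityˡ : ∀ x → 𝟘 ⊕ x ≡ x
    +-identityˡ (a ⊹ b ω) = cong₂ _⊹_ω (l a) (l b)
      where
      l : ∀ a → 0ℤ + a ≡ a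
      l = ℤ-Solver.solve-∀

    +-inverseˡ : ∀ x → (⊖ x) ⊕ x ≡ 𝟘
    +-inverseˡ (a ⊹ b ω) = cong₂ _⊹_ω (l a) (l b)
      where
      l : ∀ a → - a + a ≡ 0ℤ
      l = ℤ-Solver.solve-∀

    *-assoc : ∀ x y z → (x ⊗ y) ⊗ z ≡ x ⊗ (y ⊗ z)
    *-assoc (a ⊹ b ω) (c ⊹ d ω) (e ⊹ f ω) =
      cong₂ _⊹_ω (l n a b c d e f) (r n a b c d e f)
      where
      l : ∀ n a b c d e f →
          (a * c + - (n * (b * d))) * e + - (n * ((a * d + b * c + b * d) * f)) ≡
          a * (c * e + - (n * (d * f))) + - (n * (b * (c * f + d * e + d * f)))
      l = ℤ-Solver.solve-∀
      r : ∀ n a b c d e f →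
          (a * c + - (n * (b * d))) * f + (a * d + b * c + b * d) * e
            + (a * d + b * c + b * d) * f ≡
          a * (c * f + d * e + d * f) + b * (c * e + - (n * (d * f)))
            + b * (c * f + d * e + d * f)
      r = ℤ-Solver.solve-∀

    *-comm : ∀ x y → x ⊗ y ≡ y ⊗ x
    *-comm (a ⊹ b ω) (c ⊹ d ω) = cong₂ _⊹_ω (l n a b c d) (r a b c d)
      where
      l : ∀ n a b c d → a * c + - (n * (b * d)) ≡ c * a + - (n * (d * b))
      l = ℤ-Solver.solve-∀
      r : ∀ a b c d → a * d + b * c + b * d ≡ c * b + d * a + d * b
      r = ℤ-Solver.solve-∀

    *-identityˡ : ∀ x → 𝟙 ⊗ x ≡ x
    *-identityˡ (a ⊹ b ω) = cong₂ _⊹_ω (l n a b) (r a b)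
      where
      l : ∀ n a b → 1ℤ * a + - (n * (0ℤ * b)) ≡ a
      l = ℤ-Solver.solve-∀
      r : ∀ a b → 1ℤ * b + 0ℤ * a + 0ℤ * b ≡ b
      r = ℤ-Solver.solve-∀

    distribˡ : ∀ x y z → x ⊗ (y ⊕ z) ≡ (x ⊗ y) ⊕ (x ⊗ z)
    distribˡ (a ⊹ b ω) (c ⊹ d ω) (e ⊹ f ω) =
      cong₂ _⊹_ω (l n a b c d e f) (r a b c d e f)
      where
      l : ∀ n a b c d e f →
          a * (c + e) + - (n * (b * (d + f))) ≡
          (a * c + - (n * (b * d))) + (a * e + - (n * (b * f)))
      l = ℤ-Solver.solve-∀
      r : ∀ a b c d e f →
          a * (d + f) + b * (c + e) + b * (d + f) ≡
          (a * d + b * c + b * d) + (a * f + b * e + b * f)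
      r = ℤ-Solver.solve-∀

  quadraticRing : CommutativeRing 0ℓ 0ℓ
  quadraticRing = record
    { Carrier = Quadratic
    ; _≈_     = _≡_
    ; _+_     = _⊕_
    ; _*_     = _⊗_
    ; -_      = ⊖_
    ; 0#      = 𝟘
    ; 1#      = 𝟙
    ; isCommutativeRing = record
      { isRing = record
        { +-isAbelianGroup = record
          { isGroup = record
            { isMonoid = record
              { isSemigroup = record
                { isMagma = record { isEquivalence = isEquivalence ; ∙-cong = cong₂ _⊕_ }
                ; assoc = +-assoc
                }
              ; identity = +-identityˡ , λ x → trans (+-comm x 𝟘) (+-identityˡ x)
              }
            ; inverse = +-inverseˡ , λ x → trans (+-comm x (⊖ x)) (+-inverseˡ x)
            ; ⁻¹-cong = cong ⊖_
            }
          ; comm = +-comm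
          }
        ; *-cong     = cong₂ _⊗_
        ; *-assoc    = *-assoc
        ; *-identity = *-identityˡ , λ x → trans (*-comm x 𝟙) (*-identityˡ x)
        ; distrib    = distribˡ , λ x y z →
            trans (*-comm (y ⊕ z) x)
              (trans (distribˡ x y z) (cong₂ _⊕_ (*-comm x y) (*-comm x z)))
        }
      ; *-comm = *-comm
      }
    }

-- For a prime p ≡ 3 (mod 4), the ring of integers of ℚ(√−p) is ℤ[ω] with
-- ω = (1 + √−p) / 2, whose minimal polynomial is X² − X + (1 + p) / 4.
-- Both residues 71 and 119 mod 120 are 3 mod 4.
𝒪 : ℕ → CommutativeRing 0ℓ 0ℓ
𝒪 p = quadraticRing (Int.+ ((1 Nat.+ p) ℕ./ 4))

module _ (p : ℕ) where
  open CommutativeRing (𝒪 p) using (_+_; 1#)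
  open Ideals (𝒪 p)

  -- L = ord(2): the order in the ideal class group of ℚ(√−p) of a prime
  -- ideal above 2.
  IsOrd₂ : ℕ → Set₁
  IsOrd₂ L = Σ[ 𝔭 ∈ Ideal ] IsPrimeIdeal 𝔭 × Mem 𝔭 (1# + 1#) × IsClassOrder 𝔭 L

record SimpleGraph (n : ℕ) : Set₁ where
  field
    Adj    : Fin n → Fin n → Set
    adj?   : Decidable₂ Adj
    adjSym : ∀ {u v} → Adj u v → Adj v u
    irrefl : ∀ {u} → ¬ Adj u u
open SimpleGraph public

data Walk {n} (G : SimpleGraph n) : Fin n → Fin n → ℕ → Set where
  []  : ∀ {u} → Walk G u u 0
  _∷_ : ∀ {u x v k} → Adj G u x → Walk G x v k → Walk G u v (suc k)

Connected : ∀ {n} → SimpleGraph n → Set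
Connected G = ∀ u v → ∃[ k ] Walk G u v k

module _ {n} (G : SimpleGraph n) where

  walk? : ∀ k u v → Dec (Walk G u v k)
  walk? zero    u v = mapDec (λ { refl → [] }) (λ { [] → refl }) (u Fin.≟ v)
  walk? (suc k) u v =
    mapDec (λ (_ , a , w) → a ∷ w) (λ { (a ∷ w) → _ , a , w })
      (Fin.any? λ x → adj? G u x ×-dec walk? k x v)

  private
    snoc : ∀ {u v w k} → Walk G u v k → Adj G v w → Walk G u w (suc k)
    snoc []      a = a ∷ []
    snoc (b ∷ p) a = b ∷ snoc p a

  reverse : ∀ {u v k} → Walk G u v k → Walk G v u k
  reverse []      = []
  reverse (a ∷ p) = snoc (reverse p) (adjSym G a)

  concat : ∀ {u v w j k} → Walk G u v j → Walk G v w k → Walk G u w (j Nat.+ k)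
  concat []      q = q
  concat (a ∷ p) q = a ∷ concat p q

least : ∀ {p} {P : Pred ℕ p} → Decidable P → ∀ n → P n →
        ∃[ m ] P m × (∀ k → P k → m ≤ k)
least P? n pn with P? 0
... | yes p0 = 0 , p0 , λ _ _ → z≤n
least P? zero    p0 | no ¬p0 = contradiction p0 ¬p0
least P? (suc n) pn | no ¬p0 with least (P? ∘ suc) n pn
... | m , pm , min = suc m , pm , λ where
  zero    p0 → contradiction p0 ¬p0
  (suc k) pk → s≤s (min k pk)

module _ {n} (G : SimpleGraph n) (conn : Connected G) where

  private
    shortest : ∀ u v → ∃[ m ] Walk G u v m × (∀ k → Walk G u v k → m ≤ k)
    shortest u v = least (λ k → walk? G k u v) (proj₁ (conn u v)) (proj₂ (conn u v))

  dist : Fin n → Fin n → ℕ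
  dist u v = proj₁ (shortest u v)

  dist-attained : ∀ u v → Walk G u v (dist u v)
  dist-attained u v = proj₁ (proj₂ (shortest u v))

  dist-minimal : ∀ u v k → Walk G u v k → dist u v ≤ k
  dist-minimal u v = proj₂ (proj₂ (shortest u v))

-- The simple graph on {0, …, n−1} spanned by a list of pairs, read as
-- unordered pairs; degenerate pairs {x, x} are discarded.
fromEdges : ∀ n → List (ℕ × ℕ) → SimpleGraph n
fromEdges n E = record
  { Adj    = λ u v → u ≢ v × ((toℕ u , toℕ v) ∈ E ⊎ (toℕ v , toℕ u) ∈ E)
  ; adj?   = λ u v → ¬? (u Fin.≟ v) ×-dec
                       (((toℕ u , toℕ v) ∈? E) ⊎-dec ((toℕ v , toℕ u) ∈? E))
  ; adjSym = λ (u≢v , e) → u≢v ∘ sym , Sum.swap e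
  ; irrefl = λ (u≢u , _) → u≢u refl
  }
  where open DecMembership (×.≡-dec ℕ._≟_ ℕ._≟_) using (_∈?_)

module _ (L : ℕ) where
  open Nat using (_+_; _*_; _∸_)

  stackedEdges : List (ℕ × ℕ)
  stackedEdges =
       map (λ i → 2 * i     , 2 * i + 1) (upTo L)
    ++ map (λ i → 2 * i + 1 , 2 * i + 3) (upTo (L ∸ 1))
    ++ (2 * L ∸ 1 , 1) ∷ []

  stacked : SimpleGraph (2 * L)
  stacked = fromEdges (2 * L) stackedEdges

  private
    2i+1<2L : ∀ {i} → i < L → 2 * i + 1 < 2 * L
    2i+1<2L {i} i<L = begin-strict
      2 * i + 1  <⟨ ℕ.+-monoʳ-< (2 * i) (ℕ.n<1+n 1) ⟩
      2 * i + 2  ≡⟨ ℕ.+-comm (2 * i) 2 ⟩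
      2 + 2 * i  ≡⟨ ℕ.*-suc 2 i ⟨
      2 * suc i  ≤⟨ ℕ.*-monoʳ-≤ 2 i<L ⟩
      2 * L      ∎
      where open ℕ.≤-Reasoning

    adjacent : ∀ {u v : Fin (2 * L)} {x y} → toℕ u ≡ x → toℕ v ≡ y → x ≢ y →
               (x , y) ∈ stackedEdges → Adj stacked u v
    adjacent refl refl x≢y e = x≢y ∘ cong toℕ , inj₁ e

    spoke : ∀ i → i < L → (2 * i , 2 * i + 1) ∈ stackedEdges
    spoke i i<L = ∈.∈-++⁺ˡ (∈.∈-map⁺ _ (∈.∈-upTo⁺ i<L))

    rim : ∀ i → suc i < L → (2 * i + 1 , 2 * i + 3) ∈ stackedEdges
    rim i i+1<L = ∈.∈-++⁺ʳ (map _ (upTo L))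
      (∈.∈-++⁺ˡ (∈.∈-map⁺ _ (∈.∈-upTo⁺ (ℕ.∸-monoˡ-≤ 1 i+1<L))))

    odd : ∀ {i} → i < L → Fin (2 * L)
    odd i<L = fromℕ< (2i+1<2L i<L)

    next-odd : ∀ i → 2 * suc i + 1 ≡ 2 * i + 3
    next-odd i = trans (cong (_+ 1) (trans (ℕ.*-suc 2 i) (ℕ.+-comm 2 (2 * i))))
                       (ℕ.+-assoc (2 * i) 2 1)

    oddToOne : ∀ i (i<L : i < L) (0<L : 0 < L) → ∃[ k ] Walk stacked (odd i<L) (odd 0<L) k
    oddToOne zero    i<L 0<L = 0 , subst (λ v → Walk stacked v (odd 0<L) 0)
                                     (cong odd (ℕ.≤-irrelevant 0<L i<L)) []
    oddToOne (suc i) i+1<L 0<L with oddToOne i (ℕ.<⇒≤ i+1<L) 0<L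
    ... | k , w = suc k , adjSym stacked a ∷ w
      where
      a : Adj stacked (odd (ℕ.<⇒≤ i+1<L)) (odd i+1<L)
      a = adjacent (Fin.toℕ-fromℕ< _) (trans (Fin.toℕ-fromℕ< _) (next-odd i))
            (λ eq → contradiction (ℕ.+-cancelˡ-≡ (2 * i) 1 3 eq) λ ())
            (rim i i+1<L)

    halve : ∀ v → v < 2 * L → ∃[ i ] i < L × (v ≡ 2 * i ⊎ v ≡ 2 * i + 1)
    halve v v<2L = v ℕ./ 2 , ℕ.m<n*o⇒m/o<n (subst (v <_) (ℕ.*-comm 2 L) v<2L) , cases
      where
      v≡ : v ≡ v ℕ.% 2 + 2 * (v ℕ./ 2)
      v≡ = trans (ℕ.m≡m%n+[m/n]*n v 2) (cong (v ℕ.% 2 +_) (ℕ.*-comm (v ℕ./ 2) 2))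
      cases : v ≡ 2 * (v ℕ./ 2) ⊎ v ≡ 2 * (v ℕ./ 2) + 1
      cases with v ℕ.% 2 | ℕ.m%n<n v 2 | v≡
      ... | 0           | _ | eq = inj₁ eq
      ... | 1           | _ | eq = inj₂ (trans eq (ℕ.+-comm 1 _))
      ... | suc (suc _) | s≤s (s≤s ()) | _

    toOne : ∀ (v : Fin (2 * L)) (0<L : 0 < L) → ∃[ k ] Walk stacked v (odd 0<L) k
    toOne v 0<L with halve (toℕ v) (Fin.toℕ<n v)
    ... | i , i<L , inj₂ v≡ = subst (λ u → ∃[ k ] Walk stacked u (odd 0<L) k)
            (Fin.toℕ-injective (trans (Fin.toℕ-fromℕ< _) (sym v≡))) (oddToOne i i<L 0<L)
    ... | i , i<L , inj₁ v≡ with oddToOne i i<L 0<L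
    ...   | k , w = suc k , a ∷ w
      where
      a : Adj stacked v (odd i<L)
      a = adjacent v≡ (Fin.toℕ-fromℕ< _) (ℕ.<⇒≢ (ℕ.m<m+n (2 * i) (s≤s z≤n))) (spoke i i<L)

  stacked-connected : Connected stacked
  stacked-connected u v =
    _ , concat stacked (proj₂ (toOne u 0<L)) (reverse stacked (proj₂ (toOne v 0<L)))
    where
    0<L : 0 < L
    0<L = ℕ.*-cancelˡ-< 2 0 L (ℕ.≤-<-trans z≤n (Fin.toℕ<n u))

  stackedDist : Fin (2 * L) → Fin (2 * L) → ℕ
  stackedDist = dist stacked stacked-connected

-- The vertex v + 1, which exists for even v because 2L − 1 is odd.
next : ∀ L (v : Fin (2 Nat.* L)) → 2 ∣ toℕ v → Fin (2 Nat.* L)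
next L v 2∣v = fromℕ< (bound 2∣v)
  where
  bound : 2 ∣ toℕ v → suc (toℕ v) < 2 Nat.* L
  bound 2∣v = ℕ.≤∧≢⇒< (Fin.toℕ<n v) λ 1+v≡2L →
    contradiction
      (∣m+n∣m⇒∣n (subst (2 ∣_) (trans (sym 1+v≡2L) (ℕ.+-comm 1 (toℕ v))) (m∣m*n L)) 2∣v)
      λ { (divides zero ()) ; (divides (suc _) ()) }

{-# OPTIONS --safe #-}
-- The only neighbour of an even vertex v is v + 1, so every walk leaving v starts
-- with that edge; this gives the two cases with an even vertex.  Call {2i, 2i + 1}
-- the column i.  For odd vertices in distinct columns i and j, going round the cycle
-- in either direction gives d ≤ |i − j| and d ≤ L − |i − j|, while following the column
-- along a walk of length k shows |i − j| ≤ k or L ≤ k + |i − j|.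
module Submission where

open import Defs
open import Data.Nat using (ℕ; zero; suc; _+_; _*_; _∸_; _≤_; _<_; z≤n; s≤s; _%_; _/_; ∣_-_∣)
open import Data.Nat.Properties
open import Data.Nat.Divisibility
  using (_∣_; _∤_; divides; m∣m*n; ∣m+n∣m⇒∣n; m%n≡0⇒n∣m; ∣1⇒≡1)
open import Data.Nat.DivMod using (m≡m%n+[m/n]*n; m%n<n; m*n/n≡m; +-distrib-/-∣ˡ; /-monoˡ-≤)
open import Data.Nat.Primality using (Prime)
open import Data.Fin using (Fin; toℕ; fromℕ<)
open import Data.Fin.Properties using (toℕ-injective; toℕ-fromℕ<; toℕ<n)
open import Data.List.Base using (map; upTo)
open import Data.List.Membership.Propositional using (_∈_)
open import Data.List.Membership.Propositional.Properties
  using (∈-++⁻; ∈-++⁺ˡ; ∈-++⁺ʳ; ∈-map⁻; ∈-map⁺; ∈-upTo⁻; ∈-upTo⁺)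
open import Data.List.Relation.Unary.Any using (here)
open import Data.Product using (_×_; _,_; ∃-syntax)
open import Data.Sum using (_⊎_; inj₁; inj₂; [_,_]′)
open import Function.Base using (_∘_; case_of_)
open import Relation.Binary.PropositionalEquality
  using (_≡_; _≢_; refl; sym; trans; cong; cong₂; subst; subst₂; module ≡-Reasoning)
open import Relation.Nullary using (contradiction)

-- Arithmetic of parity and halving.

2∤2m+1 : ∀ m → 2 ∤ 2 * m + 1
2∤2m+1 m 2∣ = case ∣1⇒≡1 (∣m+n∣m⇒∣n 2∣ (m∣m*n m)) of λ ()

2m/2≡m : ∀ m → 2 * m / 2 ≡ m
2m/2≡m m = trans (cong (_/ 2) (*-comm 2 m)) (m*n/n≡m m 2)

[2m+1]/2≡m : ∀ m → (2 * m + 1) / 2 ≡ m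
[2m+1]/2≡m m = begin
  (2 * m + 1) / 2    ≡⟨ +-distrib-/-∣ˡ 1 (m∣m*n m) ⟩
  2 * m / 2 + 1 / 2  ≡⟨ cong (_+ 0) (2m/2≡m m) ⟩
  m + 0              ≡⟨ +-identityʳ m ⟩
  m                  ∎
  where open ≡-Reasoning

2∤n⇒n≡2[n/2]+1 : ∀ {n} → 2 ∤ n → n ≡ 2 * (n / 2) + 1
2∤n⇒n≡2[n/2]+1 {n} 2∤n with n % 2 in r | m%n<n n 2 | m≡m%n+[m/n]*n n 2
... | 0           | _             | _  = contradiction (m%n≡0⇒n∣m n 2 r) 2∤n
... | 1           | _             | eq =
  trans eq (trans (+-comm 1 _) (cong (_+ 1) (*-comm (n / 2) 2)))
... | suc (suc _) | s≤s (s≤s ()) | _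

2∣n⇒2∤1+n : ∀ {n} → 2 ∣ n → 2 ∤ suc n
2∣n⇒2∤1+n {n} 2∣n 2∣1+n =
  case ∣1⇒≡1 (∣m+n∣m⇒∣n (subst (2 ∣_) (+-comm 1 n) 2∣1+n) 2∣n) of λ ()

2*suc∸1 : ∀ m → 2 * suc m ∸ 1 ≡ 2 * m + 1
2*suc∸1 m = trans (cong (_∸ 1) (*-suc 2 m)) (+-comm 1 (2 * m))

2*suc+1 : ∀ i → 2 * suc i + 1 ≡ 2 * i + 3
2*suc+1 i = trans (cong (_+ 1) (trans (*-suc 2 i) (+-comm 2 (2 * i)))) (+-assoc (2 * i) 2 1)

-- Distance in a connected graph: symmetry and pendant vertices.

module _ {n} (G : SimpleGraph n) (conn : Connected G) where

  private
    d = dist G conn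

  dist-sym : ∀ u v → d u v ≡ d v u
  dist-sym u v = ≤-antisym (half u v) (half v u)
    where
    half : ∀ u v → d u v ≤ d v u
    half u v = dist-minimal G conn u v _ (reverse G (dist-attained G conn v u))

  -- Since `v ≢ w`, a walk from `v` to `w` is nonempty and starts with the edge to `x`; deleting
  -- that edge leaves a walk from `x` to `w`.
  pendant-dist : ∀ {v x w} → Adj G v x → (∀ {y} → Adj G v y → y ≡ x) → v ≢ w →
                 d v w ≡ 1 + d x w
  pendant-dist {v} {x} {w} v~x unique v≢w =
    ≤-antisym (dist-minimal G conn v w _ (v~x ∷ dist-attained G conn x w))
              (lower (dist-attained G conn v w))
    where
    lower : ∀ {k} → Walk G v w k → 1 + d x w ≤ k
    lower []      = contradiction refl v≢w
    lower (a ∷ p) with refl ← unique a = s≤s (dist-minimal G conn x w _ p)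

-- Edges of the stacked graph.

module _ (m : ℕ) where

  private
    -- The columns are `0` to `m`, and `L ∸ 1` reduces to `m`.
    L = suc m
    G = stacked L
    d = stackedDist L

    spokePair rimPair : ℕ → ℕ × ℕ
    spokePair i = 2 * i , 2 * i + 1
    rimPair i = 2 * i + 1 , 2 * i + 3

  -- The listed pairs, freed of truncated subtraction and with odd vertices of variable column in
  -- the form `2 * i + 1`, so that matching on an edge exposes the columns of its ends.
  data StackedEdge : ℕ → ℕ → Set where
    spoke   : ∀ i → i ≤ m → StackedEdge (2 * i) (2 * i + 1)
    rim     : ∀ i → suc i ≤ m → StackedEdge (2 * i + 1) (2 * suc i + 1)
    closing : StackedEdge (2 * m + 1) 1

  ∈-stackedEdges⁻ : ∀ {x y} → (x , y) ∈ stackedEdges L → StackedEdge x y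
  ∈-stackedEdges⁻ e with ∈-++⁻ (map spokePair (upTo L)) e
  ... | inj₁ e with i , i∈ , refl ← ∈-map⁻ spokePair {xs = upTo L} e = spoke i (≤-pred (∈-upTo⁻ i∈))
  ... | inj₂ e with ∈-++⁻ (map rimPair (upTo m)) e
  ...   | inj₁ e with i , i∈ , refl ← ∈-map⁻ rimPair {xs = upTo m} e =
            subst (StackedEdge _) (2*suc+1 i) (rim i (∈-upTo⁻ i∈))
  ...   | inj₂ (here refl) = subst (λ x → StackedEdge x 1) (sym (2*suc∸1 m)) closing

  ∈-stackedEdges⁺ : ∀ {x y} → StackedEdge x y → (x , y) ∈ stackedEdges L
  ∈-stackedEdges⁺ (spoke i i≤m) = ∈-++⁺ˡ (∈-map⁺ spokePair {x = i} (∈-upTo⁺ (s≤s i≤m)))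
  ∈-stackedEdges⁺ (rim i i<m)   = ∈-++⁺ʳ (map spokePair (upTo L))
    (∈-++⁺ˡ (subst (λ y → (2 * i + 1 , y) ∈ map rimPair (upTo m)) (sym (2*suc+1 i)) (∈-map⁺ rimPair (∈-upTo⁺ i<m))))
  ∈-stackedEdges⁺ closing       = ∈-++⁺ʳ (map spokePair (upTo L))
    (∈-++⁺ʳ (map rimPair (upTo m)) (here (cong (_, 1) (sym (2*suc∸1 m)))))

  edge⇒Adj : ∀ {u v x y} → toℕ u ≡ x → toℕ v ≡ y → x ≢ y → StackedEdge x y → Adj G u v
  edge⇒Adj refl refl x≢y e = x≢y ∘ cong toℕ , inj₁ (∈-stackedEdges⁺ e)

  -- An even vertex can therefore occur only as the first entry of a pair; `even-source` then leaves
  -- it a single neighbour.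
  target-odd : ∀ {x y} → StackedEdge x y → 2 ∤ y
  target-odd (spoke i _) = 2∤2m+1 i
  target-odd (rim i _)   = 2∤2m+1 (suc i)
  target-odd closing     = 2∤2m+1 0

  even-source : ∀ {x y} → StackedEdge x y → 2 ∣ x → y ≡ suc x
  even-source (spoke i _) _   = +-comm (2 * i) 1
  even-source (rim i _)   2∣x = contradiction 2∣x (2∤2m+1 i)
  even-source closing     2∣x = contradiction 2∣x (2∤2m+1 m)

  -- Even vertices as pendant vertices.

  toℕ-next : ∀ (v : Fin (2 * L)) (2∣v : 2 ∣ toℕ v) → toℕ (next L v 2∣v) ≡ suc (toℕ v)
  toℕ-next v 2∣v = toℕ-fromℕ< (≤∧≢⇒< (toℕ<n v) λ 1+v≡2L →
    2∣n⇒2∤1+n 2∣v (subst (2 ∣_) (sym 1+v≡2L) (m∣m*n L)))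

  next-unique : ∀ {v : Fin (2 * L)} (2∣v : 2 ∣ toℕ v) {y} → Adj G v y → y ≡ next L v 2∣v
  next-unique {v} 2∣v (_ , inj₁ e) =
    toℕ-injective (trans (even-source (∈-stackedEdges⁻ e) 2∣v) (sym (toℕ-next v 2∣v)))
  next-unique 2∣v (_ , inj₂ e) = contradiction 2∣v (target-odd (∈-stackedEdges⁻ e))

  column≤m : ∀ (v : Fin (2 * L)) → toℕ v / 2 ≤ m
  column≤m v = subst (toℕ v / 2 ≤_) ([2m+1]/2≡m m)
    (/-monoˡ-≤ 2 (subst (toℕ v ≤_) (2*suc∸1 m) (≤-pred (toℕ<n v))))

  next-Adj : ∀ (v : Fin (2 * L)) (2∣v : 2 ∣ toℕ v) → Adj G v (next L v 2∣v)
  next-Adj v 2∣v@(divides q v≡q2) = edge⇒Adj v≡2q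
    (trans (toℕ-next v 2∣v) (trans (cong suc v≡2q) (+-comm 1 (2 * q))))
    (<⇒≢ (m<m+n (2 * q) (s≤s z≤n)))
    (spoke q (subst (_≤ m) (trans (cong (_/ 2) v≡2q) (2m/2≡m q)) (column≤m v)))
    where
    v≡2q : toℕ v ≡ 2 * q
    v≡2q = trans v≡q2 (*-comm q 2)

  even-dist : ∀ (v w : Fin (2 * L)) (2∣v : 2 ∣ toℕ v) → v ≢ w →
              d v w ≡ 1 + d (next L v 2∣v) w
  even-dist v w 2∣v v≢w =
    pendant-dist G (stacked-connected L) (next-Adj v 2∣v) (next-unique 2∣v) v≢w

  -- The pendant edge is removed at `v` and then, after swapping the arguments, at `w`. The second
  -- removal is legitimate because `w` is even and `v⁺` is odd.
  even-even-dist : ∀ (v w : Fin (2 * L)) (2∣v : 2 ∣ toℕ v) (2∣w : 2 ∣ toℕ w) → v ≢ w →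
                   d v w ≡ 2 + d (next L v 2∣v) (next L w 2∣w)
  even-even-dist v w 2∣v 2∣w v≢w = begin
    d v w           ≡⟨ even-dist v w 2∣v v≢w ⟩
    1 + d v⁺ w      ≡⟨ cong suc (dist-sym G conn v⁺ w) ⟩
    1 + d w v⁺      ≡⟨ cong suc (even-dist w v⁺ 2∣w w≢v⁺) ⟩
    2 + d w⁺ v⁺     ≡⟨ cong (2 +_) (dist-sym G conn w⁺ v⁺) ⟩
    2 + d v⁺ w⁺     ∎
    where
    open ≡-Reasoning
    conn = stacked-connected L
    v⁺ = next L v 2∣v
    w⁺ = next L w 2∣w
    w≢v⁺ : w ≢ v⁺
    w≢v⁺ w≡v⁺ = 2∣n⇒2∤1+n 2∣v (subst (2 ∣_) (trans (cong toℕ w≡v⁺) (toℕ-next v 2∣v)) 2∣w)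

  -- Lower bound: columns along a walk.

  -- The second alternative is the passage between the columns m and 0.
  Step : ℕ → ℕ → Set
  Step a b = ∣ a - b ∣ ≤ 1 ⊎ (∀ {j} → j ≤ m → ∣ a - j ∣ + ∣ b - j ∣ ≡ m)

  Step-sym : ∀ a b → Step a b → Step b a
  Step-sym a b (inj₁ near) = inj₁ (subst (_≤ 1) (∣-∣-comm a b) near)
  Step-sym a b (inj₂ wrap) =
    inj₂ λ {j} j≤m → trans (+-comm ∣ b - j ∣ ∣ a - j ∣) (wrap j≤m)

  edge⇒Step : ∀ {x y} → StackedEdge x y → Step (x / 2) (y / 2)
  edge⇒Step (spoke i _) rewrite 2m/2≡m i | [2m+1]/2≡m i | ∣n-n∣≡0 i = inj₁ z≤n
  edge⇒Step (rim i _)   rewrite [2m+1]/2≡m i | [2m+1]/2≡m (suc i) =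
    inj₁ (≤-reflexive (trans (cong (∣ i -_∣) (+-comm 1 i)) (∣m-m+n∣≡n i 1)))
  -- The columns are `m` and `0`, so the sum is `(m ∸ j) + j`.
  edge⇒Step closing     rewrite [2m+1]/2≡m m =
    inj₂ λ j≤m → trans (cong (_+ _) (m≤n⇒∣n-m∣≡n∸m j≤m)) (m∸n+n≡m j≤m)

  Adj⇒Step : ∀ {u v} → Adj G u v → Step (toℕ u / 2) (toℕ v / 2)
  Adj⇒Step (_ , inj₁ e) = edge⇒Step (∈-stackedEdges⁻ e)
  Adj⇒Step {u} {v} (_ , inj₂ e) = Step-sym (toℕ v / 2) (toℕ u / 2) (edge⇒Step (∈-stackedEdges⁻ e))

  -- A near step changes the column distance to `j` by at most one, which preserves the alternative.
  -- A wrap replaces that distance `c` by `m ∸ c`, which exchanges the two alternatives.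
  prepend-step : ∀ {a b j k} → j ≤ m → Step a b →
                 ∣ b - j ∣ ≤ k     ⊎ L ≤ k + ∣ b - j ∣ →
                 ∣ a - j ∣ ≤ suc k ⊎ L ≤ suc k + ∣ a - j ∣
  prepend-step {a} {b} {j} _ (inj₁ near) (inj₁ short) =
    inj₁ (≤-trans (∣-∣-triangle a b j) (+-mono-≤ near short))
  prepend-step {a} {b} {j} {k} _ (inj₁ near) (inj₂ long) = inj₂ (begin
    L                          ≤⟨ long ⟩
    k + ∣ b - j ∣              ≤⟨ +-monoʳ-≤ k (∣-∣-triangle b a j) ⟩
    k + (∣ b - a ∣ + ∣ a - j ∣)  ≤⟨ +-monoʳ-≤ k (+-monoˡ-≤ _ (subst (_≤ 1) (∣-∣-comm a b) near)) ⟩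
    k + suc ∣ a - j ∣          ≡⟨ +-suc k _ ⟩
    suc k + ∣ a - j ∣          ∎)
    where open ≤-Reasoning
  prepend-step {a} {b} {j} {k} j≤m (inj₂ wrap) (inj₁ short) = inj₂ (s≤s (begin
    m                      ≡⟨ wrap j≤m ⟨
    ∣ a - j ∣ + ∣ b - j ∣  ≤⟨ +-monoʳ-≤ _ short ⟩
    ∣ a - j ∣ + k          ≡⟨ +-comm _ k ⟩
    k + ∣ a - j ∣          ∎))
    where open ≤-Reasoning
  prepend-step {a} {b} {j} {k} j≤m (inj₂ wrap) (inj₂ long) =
    inj₁ (m≤n⇒m≤1+n (+-cancelʳ-≤ ∣ b - j ∣ ∣ a - j ∣ k
      (≤-trans (≤-reflexive (wrap j≤m)) (<⇒≤ long))))

  walk-length≥ : ∀ {u v k} → Walk G u v k →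
                 ∣ toℕ u / 2 - toℕ v / 2 ∣ ≤ k ⊎ L ≤ k + ∣ toℕ u / 2 - toℕ v / 2 ∣
  walk-length≥ {u} [] = inj₁ (≤-reflexive (∣n-n∣≡0 (toℕ u / 2)))
  walk-length≥ {u} {v} (_∷_ {x = x} a p) =
    prepend-step {toℕ u / 2} {toℕ x / 2} (column≤m v) (Adj⇒Step {u} {x} a) (walk-length≥ p)

  -- Upper bounds: walks in both directions round the cycle.

  oddVertex : ∀ {i} → i ≤ m → ∃[ v ] toℕ {2 * L} v ≡ 2 * i + 1
  oddVertex {i} i≤m = fromℕ< 2i+1<2L , toℕ-fromℕ< 2i+1<2L
    where
    2i+1<2L : 2 * i + 1 < 2 * L
    2i+1<2L = begin-strict
      2 * i + 1          ≤⟨ +-monoˡ-≤ 1 (*-monoʳ-≤ 2 i≤m) ⟩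
      2 * m + 1          ≡⟨ 2*suc∸1 m ⟨
      -- `2 * L` reduces to a successor, whose predecessor is `2 * L ∸ 1`.
      2 * L ∸ 1          <⟨ ≤-refl ⟩
      2 * L              ∎
      where open ≤-Reasoning

  rimWalk : ∀ k {i u v} → k + i ≤ m → toℕ u ≡ 2 * (k + i) + 1 → toℕ v ≡ 2 * i + 1 →
            Walk G u v k
  rimWalk zero        _     u≡ v≡ with refl ← toℕ-injective (trans u≡ (sym v≡)) = []
  rimWalk (suc k) {i} k+i<m u≡ v≡ with x , x≡ ← oddVertex (<⇒≤ k+i<m) =
    adjSym G {x} (edge⇒Adj x≡ u≡ (<⇒≢ (+-monoˡ-< 1 (*-monoʳ-< 2 (n<1+n (k + i)))))
                   (rim (k + i) k+i<m))
    ∷ rimWalk k (<⇒≤ k+i<m) x≡ v≡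

  -- Up the rim from column `b` to `m`, across the closing edge to column `0`, then up to `a`. For
  -- `m = 0` the closing pair would be the discarded loop at `1`; `0 < m` excludes this.
  aroundWalk : ∀ {a b u v} → 0 < m → b ≤ m → a ≤ m →
               toℕ u ≡ 2 * b + 1 → toℕ v ≡ 2 * a + 1 →
               Walk G u v ((m ∸ b) + suc a)
  aroundWalk {a} {b} 0<m b≤m a≤m u≡ v≡
    with x , x≡ ← oddVertex ≤-refl | y , y≡ ← oddVertex {0} z≤n =
    concat G (reverse G (rimWalk (m ∸ b) (≤-reflexive (m∸n+n≡m b≤m))
                           (trans x≡ (cong (λ j → 2 * j + 1) (sym (m∸n+n≡m b≤m)))) u≡))
      (edge⇒Adj x≡ y≡ (λ eq → <⇒≢ (+-monoˡ-< 1 (*-monoʳ-< 2 0<m)) (sym eq)) closing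
       ∷ reverse G (rimWalk a (subst (_≤ m) (sym (+-identityʳ a)) a≤m)
                      (trans v≡ (cong (λ j → 2 * j + 1) (sym (+-identityʳ a)))) y≡))

  -- Distance between odd vertices.

  -- Stated for arbitrary `δ` and `n` so that it can be transported along `δ ≡ 2 * k` and along the
  -- symmetry of the distance.
  CycleFormula : ℕ → ℕ → Set
  CycleFormula δ n = (δ ≤ m → n ≡ δ / 2) × (L + 1 ≤ δ → n ≡ L ∸ δ / 2)

  -- The bounds make `n` the smaller of `k` and `L ∸ k`. If `2 * k ≤ m`, then `L ≤ n + k` is absurd;
  -- if `L < 2 * k`, then even `k ≤ n` yields `L ≤ n + k`. The guard `0 < k` is what supplies
  -- `0 < m` for `aroundWalk`.
  cycleFormula : ∀ {k n} → n ≤ k → (0 < k → n + k ≤ L) → k ≤ n ⊎ L ≤ n + k →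
                 CycleFormula (2 * k) n
  cycleFormula {k} {n} n≤k upper lower rewrite 2m/2≡m k = near , far
    where
    n+k≤2k : n + k ≤ 2 * k
    n+k≤2k = ≤-trans (+-monoˡ-≤ k n≤k) (≤-reflexive (cong (k +_) (sym (+-identityʳ k))))

    near : 2 * k ≤ m → n ≡ k
    near 2k≤m =
      [ ≤-antisym n≤k
      , (λ L≤ → contradiction (≤-trans L≤ (≤-trans n+k≤2k 2k≤m)) 1+n≰n)
      ]′ lower

    far : L + 1 ≤ 2 * k → n ≡ L ∸ k
    far L<2k = sym (trans (cong (_∸ k) L≡n+k) (m+n∸n≡m n k))
      where
      0<k : 0 < k
      0<k = *-cancelˡ-< 2 0 k (≤-trans (s≤s z≤n) L<2k)
      L≤n+k : k ≤ n ⊎ L ≤ n + k → L ≤ n + k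
      L≤n+k (inj₂ L≤) = L≤
      L≤n+k (inj₁ k≤n) = ≤-trans (m+n≤o⇒m≤o L L<2k)
        (≤-trans (≤-reflexive (cong (k +_) (+-identityʳ k))) (+-monoˡ-≤ k k≤n))
      L≡n+k : L ≡ n + k
      L≡n+k = ≤-antisym (L≤n+k lower) (upper 0<k)

  odd-dist-≤ : ∀ (v w : Fin (2 * L)) → 2 ∤ toℕ v → 2 ∤ toℕ w → toℕ w / 2 ≤ toℕ v / 2 →
               CycleFormula ∣ toℕ v - toℕ w ∣ (d v w)
  odd-dist-≤ v w 2∤v 2∤w a≤b = subst (λ δ → CycleFormula δ (d v w)) (sym δ≡2k)
    (cycleFormula (dist-minimal G conn v w k (rimWalk k k+a≤m v≡′ w≡)) upper lower)
    where
    conn = stacked-connected L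
    a = toℕ w / 2
    b = toℕ v / 2
    k = b ∸ a

    v≡ : toℕ v ≡ 2 * b + 1
    v≡ = 2∤n⇒n≡2[n/2]+1 2∤v

    w≡ : toℕ w ≡ 2 * a + 1
    w≡ = 2∤n⇒n≡2[n/2]+1 2∤w

    v≡′ : toℕ v ≡ 2 * (k + a) + 1
    v≡′ = trans v≡ (cong (λ j → 2 * j + 1) (sym (m∸n+n≡m a≤b)))

    k+a≤m : k + a ≤ m
    k+a≤m = subst (_≤ m) (sym (m∸n+n≡m a≤b)) (column≤m v)

    δ≡2k : ∣ toℕ v - toℕ w ∣ ≡ 2 * k
    δ≡2k = begin
      ∣ toℕ v - toℕ w ∣            ≡⟨ cong₂ ∣_-_∣ v≡ w≡ ⟩
      -- With the `1` in front, both successors cancel by computation.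
      ∣ 2 * b + 1 - 2 * a + 1 ∣    ≡⟨ cong₂ ∣_-_∣ (+-comm (2 * b) 1) (+-comm (2 * a) 1) ⟩
      ∣ 2 * b - 2 * a ∣            ≡⟨ *-distribˡ-∣-∣ 2 b a ⟨
      2 * ∣ b - a ∣                ≡⟨ cong (2 *_) (m≤n⇒∣n-m∣≡n∸m a≤b) ⟩
      2 * k                        ∎
      where open ≡-Reasoning

    -- The direct and the roundabout walk together traverse the whole cycle, so their lengths add up
    -- to `L`.
    upper : 0 < k → d v w + k ≤ L
    upper 0<k = begin
      d v w + k                  ≤⟨ +-monoˡ-≤ k (dist-minimal G conn v w _
                                     (aroundWalk 0<m (column≤m v) (column≤m w) v≡ w≡)) ⟩
      (m ∸ b) + suc a + k        ≡⟨ +-assoc (m ∸ b) (suc a) k ⟩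
      (m ∸ b) + suc (a + k)      ≡⟨ cong (λ j → (m ∸ b) + suc j) (m+[n∸m]≡n a≤b) ⟩
      (m ∸ b) + suc b            ≡⟨ +-suc (m ∸ b) b ⟩
      suc (m ∸ b + b)            ≡⟨ cong suc (m∸n+n≡m (column≤m v)) ⟩
      L                          ∎
      where
      open ≤-Reasoning
      0<m : 0 < m
      0<m = ≤-trans 0<k (≤-trans (m∸n≤m b a) (column≤m v))

    lower : k ≤ d v w ⊎ L ≤ d v w + k
    lower = subst (λ c → c ≤ d v w ⊎ L ≤ d v w + c) (m≤n⇒∣n-m∣≡n∸m a≤b)
      (walk-length≥ (dist-attained G conn v w))

  -- Both `d` and the absolute difference are symmetric, so the columns may be taken in order.
  odd-dist : ∀ (v w : Fin (2 * L)) → 2 ∤ toℕ v → 2 ∤ toℕ w →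
             CycleFormula ∣ toℕ v - toℕ w ∣ (d v w)
  odd-dist v w 2∤v 2∤w =
    [ (λ b≤a → subst₂ CycleFormula (∣-∣-comm (toℕ w) (toℕ v))
                 (dist-sym G (stacked-connected L) w v) (odd-dist-≤ w v 2∤w 2∤v b≤a))
    , odd-dist-≤ v w 2∤v 2∤w
    ]′ (≤-total (toℕ v / 2) (toℕ w / 2))

proposition29 :
  (p : ℕ) → Prime p → p % 120 ≡ 71 ⊎ p % 120 ≡ 119 →
  (L : ℕ) → IsOrd₂ p L →
  (v w : Fin (2 * L)) → v ≢ w →
  let d = stackedDist L
      δ = ∣ toℕ v - toℕ w ∣
  in
    (2 ∤ toℕ v → 2 ∤ toℕ w →
      (δ ≤ L ∸ 1 → d v w ≡ δ / 2) ×
      (L + 1 ≤ δ → d v w ≡ L ∸ δ / 2)) ×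
    ((v-even : 2 ∣ toℕ v) → 2 ∤ toℕ w →
      d v w ≡ 1 + d (next L v v-even) w) ×
    ((v-even : 2 ∣ toℕ v) → (w-even : 2 ∣ toℕ w) →
      d v w ≡ 2 + d (next L v v-even) (next L w w-even))
proposition29 p _ _ zero    _ ()
proposition29 p _ _ (suc m) _ v w v≢w =
  odd-dist m v w ,
  (λ 2∣v _ → even-dist m v w 2∣v v≢w) ,
  (λ 2∣v 2∣w → even-even-dist m v w 2∣v 2∣w v≢w)
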